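{- Let $p,q>1$ be coprime integers, and let $S(p,q)=\{ap+bq : a,b\in\mathbb{Z}_{\ge 0}\}$. Then $$P_{S(p,q)}(x)=(1-x)\sum_{s\in S(p,q)}x^s=\frac{(x^{pq}-1)(x-1)}{(x^p-1)(x^q-1)}.$$
   Context: A numerical semigroup is a set of the form $S=\{x_1a_1+\cdots+x_ma_m : x_i\in\mathbb{Z}_{\ge 0}\}$, with $a_1,\ldots,a_m$ positive integers, whose complement $\mathbb{Z}_{\ge 0}\setminus S$ is finite; $S(p,q)$ is numerical when $p,q$ are coprime. The Hilbert series of $S$ is the formal power series $H_S(x)=\sum_{s\in S}x^s\in\mathbb{Z}[[x]]$, and the semigroup polynomial of $S$ is $P_S(x)=(1-x)H_S(x)$, which is a polynomial. The identity is one of formal power series in $x$. -}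

module Defs where

open import Data.Fin using (zero; suc; toℕ; fromℕ<)
open import Data.Fin.Properties using (any?; toℕ-fromℕ<)
open import Data.Integer as ℤ using (ℤ; +_; -[1+_]; 0ℤ; 1ℤ; ∣_∣)
import Data.Integer.Properties as ℤ
open import Algebra.Properties.Semiring.Sum ℤ.+-*-semiring using (sum⁺-syntax)
open import Data.Integer.Tactic.RingSolver using (solve-∀)
open import Data.Nat as ℕ using (ℕ; zero; suc; 2+; _∸_; _≤_; z≤n; s≤s; NonTrivial)
import Data.Nat.Properties as ℕ
open import Data.Product using (∃₂; ∃-syntax; _×_; _,_)
open import Data.Bool using (if_then_else_)
open import Relation.Binary.PropositionalEquality
open import Relation.Nullary using (does)
open import Relation.Nullary.Decidable using (map′)
open import Relation.Unary using (Pred; Decidable)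
open import Level using (0ℓ)

-- ℤ[[x]]: f n is the coefficient of xⁿ, and equality is _≗_.

PowerSeries : Set
PowerSeries = ℕ → ℤ

infixl 7 _*_ _/_
infixl 6 _-_
infix  8 x^_

-- Σ_{s ∈ P} xˢ
hilbertSeries : {P : Pred ℕ 0ℓ} → Decidable P → PowerSeries
hilbertSeries P? n = if does (P? n) then 1ℤ else 0ℤ

x^_ : ℕ → PowerSeries
(x^ k) n = if does (n ℕ.≟ k) then 1ℤ else 0ℤ

one x : PowerSeries
one = x^ 0
x   = x^ 1

_-_ : PowerSeries → PowerSeries → PowerSeries
(f - g) n = f n ℤ.- g n

_*_ : PowerSeries → PowerSeries → PowerSeries
(f * g) n = ∑[ k ≤ n ] (f (toℕ k) ℤ.* g (n ∸ toℕ k))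

-- A series over ℤ is a unit iff its constant coefficient is ±1.
record Invertible (f : PowerSeries) : Set where
  constructor invertible
  field
    ∣f₀∣≡1 : ∣ f 0 ∣ ≡ 1

-- Long division, for g₀ = ±1: since g₀⁻¹ = g₀, the constant coefficient of
-- f / g is f₀ · g₀, and the remaining ones are those of r / g, where
-- r = (f − f₀ · g₀ · g) / x.
remainder : PowerSeries → PowerSeries → PowerSeries
remainder f g n = f (suc n) ℤ.- f 0 ℤ.* g 0 ℤ.* g (suc n)

_/_ : (f g : PowerSeries) → .{{Invertible g}} → PowerSeries
(f / g) zero    = f 0 ℤ.* g 0
(f / g) (suc n) = (remainder f g / g) n

private
  unit² : ∀ i → ∣ i ∣ ≡ 1 → i ℤ.* i ≡ 1ℤ
  unit² (+ 1)    refl = refl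
  unit² -[1+ 0 ] refl = refl

  cancel : ∀ a b → a ℤ.+ (b ℤ.- a) ≡ b
  cancel = solve-∀

/-* : ∀ f g {{_ : Invertible g}} → (f / g) * g ≗ f
/-* f g {{invertible u}} zero = begin
  f 0 ℤ.* g 0 ℤ.* g 0 ℤ.+ 0ℤ ≡⟨ ℤ.+-identityʳ _ ⟩
  f 0 ℤ.* g 0 ℤ.* g 0        ≡⟨ ℤ.*-assoc (f 0) (g 0) (g 0) ⟩
  f 0 ℤ.* (g 0 ℤ.* g 0)      ≡⟨ cong (f 0 ℤ.*_) (unit² (g 0) u) ⟩
  f 0 ℤ.* 1ℤ                 ≡⟨ ℤ.*-identityʳ _ ⟩
  f 0                        ∎
  where open ≡-Reasoning
/-* f g (suc n) = trans
  (cong (λ i → f 0 ℤ.* g 0 ℤ.* g (suc n) ℤ.+ i) (/-* (remainder f g) g n))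
  (cancel (f 0 ℤ.* g 0 ℤ.* g (suc n)) (f (suc n)))

instance
  x^-one-invertible : ∀ {k} .{{_ : NonTrivial k}} → Invertible (x^ k - one)
  x^-one-invertible {2+ _} = invertible refl

  *-invertible : ∀ {f g} {{_ : Invertible f}} {{_ : Invertible g}} → Invertible (f * g)
  *-invertible {f} {g} {{invertible u}} {{invertible v}} = invertible (begin
    ∣ f 0 ℤ.* g 0 ℤ.+ 0ℤ ∣  ≡⟨ cong ∣_∣ (ℤ.+-identityʳ (f 0 ℤ.* g 0)) ⟩
    ∣ f 0 ℤ.* g 0 ∣         ≡⟨ ℤ.abs-* (f 0) (g 0) ⟩
    ∣ f 0 ∣ ℕ.* ∣ g 0 ∣     ≡⟨ cong₂ ℕ._*_ u v ⟩
    1                       ∎)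
    where open ≡-Reasoning

semigroupPolynomial : {P : Pred ℕ 0ℓ} → Decidable P → PowerSeries
semigroupPolynomial P? = (one - x) * hilbertSeries P?

S : ℕ → ℕ → Pred ℕ 0ℓ
S p q n = ∃₂ λ a b → n ≡ a ℕ.* p ℕ.+ b ℕ.* q

private
  -- A multiple a · p can be written with a multiplier at most a · p;
  -- only p = 0 requires changing a.
  shrink : ∀ p a → ∃[ a′ ] a′ ≤ a ℕ.* p × a′ ℕ.* p ≡ a ℕ.* p
  shrink zero      a = 0 , z≤n , sym (ℕ.*-zeroʳ a)
  shrink p@(suc _) a = a , ℕ.m≤m*n a p , refl

S? : ∀ p q → Decidable (S p q)
S? p q n = map′
  (λ (a , b , eq) → toℕ a , toℕ b , eq)
  bounded
  (any? {n = suc n} λ a → any? {n = suc n} λ b →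
    n ℕ.≟ toℕ a ℕ.* p ℕ.+ toℕ b ℕ.* q)
  where
  bounded : S p q n → ∃₂ λ a b → n ≡ toℕ {suc n} a ℕ.* p ℕ.+ toℕ {suc n} b ℕ.* q
  bounded (a , b , refl) with shrink p a | shrink q b
  ... | a′ , a′≤ , a′p≡ap | b′ , b′≤ , b′q≡bq =
    fromℕ< a′<1+n , fromℕ< b′<1+n , sym (cong₂ ℕ._+_
      (trans (cong (ℕ._* p) (toℕ-fromℕ< a′<1+n)) a′p≡ap)
      (trans (cong (ℕ._* q) (toℕ-fromℕ< b′<1+n)) b′q≡bq))
    where
    a′<1+n : a′ ℕ.< suc (a ℕ.* p ℕ.+ b ℕ.* q)
    a′<1+n = s≤s (ℕ.≤-trans a′≤ (ℕ.m≤m+n _ _))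
    b′<1+n : b′ ℕ.< suc (a ℕ.* p ℕ.+ b ℕ.* q)
    b′<1+n = s≤s (ℕ.≤-trans b′≤ (ℕ.m≤n+m _ _))

{-# OPTIONS --safe #-}
module Submission where

open import Defs
open import Data.Nat as ℕ using (ℕ; NonTrivial)
open import Data.Nat.Coprimality using (Coprime)
open import Data.Product using (_×_)
open import Relation.Binary.PropositionalEquality using (_≗_)

open import Data.Empty using (⊥-elim)
open import Data.Fin using (toℕ)
open import Data.Integer as ℤ using (ℤ; +_; -[1+_]; 0ℤ; 1ℤ; -1ℤ; ∣_∣)
import Data.Integer.Properties as ℤ
open import Algebra.Properties.Semiring.Sum ℤ.+-*-semiring using (sum-cong-≗)
open import Data.Integer.Tactic.RingSolver using (solve; solve-∀)
open import Data.List using ([]; _∷_)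
open import Data.Nat using (zero; suc; _∸_; _≤_; _<_; z≤n; s≤s; NonZero)
open import Data.Nat.Coprimality as Coprimality using (coprime-divisor)
open import Data.Nat.Divisibility using (divides; >⇒∤)
import Data.Nat.Properties as ℕ
open import Algebra.Properties.CommutativeSemigroup ℕ.+-commutativeSemigroup using (x∙yz≈y∙xz)
open import Data.Product using (∃; ∃₂; _,_)
open import Data.Sum using (_⊎_; inj₁; inj₂)
open import Function using (_⇔_; mk⇔; Equivalence)
open import Level using (0ℓ)
open import Relation.Binary.PropositionalEquality hiding (_≗_)
import Relation.Binary.Reasoning.Setoid as ≈-Reasoning
open import Relation.Nullary using (¬_; yes; no)
open import Relation.Nullary.Decidable using (_×-dec_)
open import Relation.Unary using (Pred; Decidable)

-- The Apéry set of S(p,q) with respect to q is {ap : a < q}, so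
-- S(p,q) = {ap : a < q} ⊔ (q + S(p,q)), that is (1 − x^q) H_S = Σ_{a<q} x^{ap}.
-- Multiplying by 1 − x^p makes the geometric sum telescope to 1 − x^{pq}.

-- Ring laws for formal power series.

tail : PowerSeries → PowerSeries
tail f n = f (suc n)

*-cong : ∀ {f f′ g g′} → f ≗ f′ → g ≗ g′ → f * g ≗ f′ * g′
*-cong f≗f′ g≗g′ n =
  sum-cong-≗ {suc n} λ k → cong₂ ℤ._*_ (f≗f′ (toℕ k)) (g≗g′ (n ∸ toℕ k))

*-congˡ : ∀ f {g g′} → g ≗ g′ → f * g ≗ f * g′
*-congˡ f {g} {g′} = *-cong {f} {f} {g} {g′} λ _ → refl

*-congʳ : ∀ {f f′} g → f ≗ f′ → f * g ≗ f′ * g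
*-congʳ {f} {f′} g f≗f′ = *-cong {f} {f′} {g} {g} f≗f′ λ _ → refl

-- The combination `c · f + g` has the shape of the tail of a product, `f 0 · tail g + tail f * g`,
-- which is what associativity needs. With `c = -1` it also gives distributivity over subtraction.
*-linearʳ : ∀ c f g h →
  (λ n → c ℤ.* f n ℤ.+ g n) * h ≗ λ n → c ℤ.* (f * h) n ℤ.+ (g * h) n
*-linearʳ c f g h zero = lemma c (f 0) (g 0) (h 0)
  where
  lemma : ∀ c a b d → (c ℤ.* a ℤ.+ b) ℤ.* d ℤ.+ 0ℤ ≡
                      c ℤ.* (a ℤ.* d ℤ.+ 0ℤ) ℤ.+ (b ℤ.* d ℤ.+ 0ℤ)
  lemma = solve-∀
*-linearʳ c f g h (suc n) = trans
  (cong (λ i → (c ℤ.* f 0 ℤ.+ g 0) ℤ.* h (suc n) ℤ.+ i) (*-linearʳ c (tail f) (tail g) h n))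
  (lemma c (f 0) (g 0) (h (suc n)) ((tail f * h) n) ((tail g * h) n))
  where
  lemma : ∀ c a b d u v → (c ℤ.* a ℤ.+ b) ℤ.* d ℤ.+ (c ℤ.* u ℤ.+ v) ≡
                          c ℤ.* (a ℤ.* d ℤ.+ u) ℤ.+ (b ℤ.* d ℤ.+ v)
  lemma = solve-∀

*-distribʳ-- : ∀ f g h → (g - h) * f ≗ g * f - h * f
*-distribʳ-- f g h n = begin
  ((g - h) * f) n                          ≡⟨ *-congʳ f (λ i → lemma (g i) (h i)) n ⟩
  ((λ i → -1ℤ ℤ.* h i ℤ.+ g i) * f) n      ≡⟨ *-linearʳ -1ℤ h g f n ⟩
  -1ℤ ℤ.* (h * f) n ℤ.+ (g * f) n          ≡⟨ lemma ((g * f) n) ((h * f) n) ⟨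
  (g * f - h * f) n                        ∎
  where
  open ≡-Reasoning
  lemma : ∀ a b → a ℤ.- b ≡ -1ℤ ℤ.* b ℤ.+ a
  lemma = solve-∀

*-assoc : ∀ f g h → (f * g) * h ≗ f * (g * h)
*-assoc f g h zero = lemma (f 0) (g 0) (h 0)
  where
  lemma : ∀ a b c → (a ℤ.* b ℤ.+ 0ℤ) ℤ.* c ℤ.+ 0ℤ ≡ a ℤ.* (b ℤ.* c ℤ.+ 0ℤ) ℤ.+ 0ℤ
  lemma = solve-∀
*-assoc f g h (suc n) = begin
  (f * g) 0 ℤ.* h (suc n) ℤ.+ (tail (f * g) * h) n
    -- By definition `tail (f * g)` is `f 0 · tail g + tail f * g`, so linearity applies directly.
    ≡⟨ cong (λ i → (f * g) 0 ℤ.* h (suc n) ℤ.+ i) (*-linearʳ (f 0) (tail g) (tail f * g) h n) ⟩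
  (f * g) 0 ℤ.* h (suc n) ℤ.+ (f 0 ℤ.* (tail g * h) n ℤ.+ ((tail f * g) * h) n)
    ≡⟨ cong (λ i → (f * g) 0 ℤ.* h (suc n) ℤ.+ (f 0 ℤ.* (tail g * h) n ℤ.+ i))
         (*-assoc (tail f) g h n) ⟩
  (f * g) 0 ℤ.* h (suc n) ℤ.+ (f 0 ℤ.* (tail g * h) n ℤ.+ (tail f * (g * h)) n)
    ≡⟨ lemma (f 0) (g 0) (h (suc n)) ((tail g * h) n) ((tail f * (g * h)) n) ⟩
  (f * (g * h)) (suc n)
    ∎
  where
  open ≡-Reasoning
  lemma : ∀ a b c u v → (a ℤ.* b ℤ.+ 0ℤ) ℤ.* c ℤ.+ (a ℤ.* u ℤ.+ v) ≡
                        a ℤ.* (b ℤ.* c ℤ.+ u) ℤ.+ v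
  lemma = solve-∀

-- The convolution unfolds by itself only at its first term. Commutativity reverses the order of
-- summation, so it must also split off the last one.
*-last : ∀ f g n → (f * g) (suc n) ≡ (f * tail g) n ℤ.+ f (suc n) ℤ.* g 0
*-last f g zero = lemma (f 0 ℤ.* g 1) (f 1 ℤ.* g 0)
  where
  lemma : ∀ a b → a ℤ.+ (b ℤ.+ 0ℤ) ≡ a ℤ.+ 0ℤ ℤ.+ b
  lemma = solve-∀
*-last f g (suc n) = trans
  (cong (λ i → f 0 ℤ.* g (suc (suc n)) ℤ.+ i) (*-last (tail f) g n))
  (sym (ℤ.+-assoc (f 0 ℤ.* g (suc (suc n))) ((tail f * tail g) n) _))

*-comm : ∀ f g → f * g ≗ g * f
*-comm f g zero    = cong (ℤ._+ 0ℤ) (ℤ.*-comm (f 0) (g 0))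
*-comm f g (suc n) = begin
  f 0 ℤ.* g (suc n) ℤ.+ (tail f * g) n ≡⟨ ℤ.+-comm _ ((tail f * g) n) ⟩
  (tail f * g) n ℤ.+ f 0 ℤ.* g (suc n) ≡⟨ cong₂ ℤ._+_ (*-comm (tail f) g n) (ℤ.*-comm (f 0) _) ⟩
  (g * tail f) n ℤ.+ g (suc n) ℤ.* f 0 ≡⟨ *-last g f n ⟨
  (g * f) (suc n)                      ∎
  where open ≡-Reasoning

-- Passes between the factors `x^ k - one` of the quotient and the factors `one - x^ k`, which suit
-- Hilbert series; the two signs cancel.
swap-signs : ∀ f g h k → (f - g) * (h - k) ≗ (g - f) * (k - h)
swap-signs f g h k n = sum-cong-≗ {suc n} λ i →
  lemma (f (toℕ i)) (g (toℕ i)) (h (n ∸ toℕ i)) (k (n ∸ toℕ i))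
  where
  lemma : ∀ a b c d → (a ℤ.- b) ℤ.* (c ℤ.- d) ≡ (b ℤ.- a) ℤ.* (d ℤ.- c)
  lemma = solve-∀

*-zeroˡ : ∀ f → (λ _ → 0ℤ) * f ≗ λ _ → 0ℤ
*-zeroˡ f zero    = refl
*-zeroˡ f (suc n) = trans (ℤ.+-identityˡ _) (*-zeroˡ f n)

*-identityˡ : ∀ f → one * f ≗ f
*-identityˡ f zero    = trans (ℤ.+-identityʳ _) (ℤ.*-identityˡ (f 0))
*-identityˡ f (suc n) = trans
  (cong₂ ℤ._+_ (ℤ.*-identityˡ (f (suc n))) (*-zeroˡ f n))
  (ℤ.+-identityʳ _)

one-minus-* : ∀ g f → (one - g) * f ≗ f - g * f
one-minus-* g f n = trans
  (*-distribʳ-- f one g n)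
  (cong (λ i → i ℤ.- (g * f) n) (*-identityˡ f n))

-- Since `g 0` is its own inverse, the constant coefficient of `h * g` determines `h 0` as
-- `f 0 · g 0`. Removing its contribution and dividing by x leaves `tail h * g ≗ remainder f g`, the
-- same problem that long division recurses on; hence the induction varies `f` and `h`.
/-unique : ∀ f g h .{{_ : Invertible g}} → h * g ≗ f → h ≗ f / g
/-unique f g h {{inv}} hg≗f = go f h hg≗f
  where
  -- Invertibility is available only irrelevantly here, so the cases are on the integer and not on
  -- the proof.
  unit² : ∀ i → .(∣ i ∣ ≡ 1) → i ℤ.* i ≡ 1ℤ
  unit² (+ 1)    _ = refl
  unit² -[1+ 0 ] _ = refl

  leading : ∀ f h → h * g ≗ f → h 0 ≡ f 0 ℤ.* g 0
  leading f h hg≗f = begin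
    h 0                           ≡⟨ ℤ.*-identityʳ (h 0) ⟨
    h 0 ℤ.* 1ℤ                    ≡⟨ cong (h 0 ℤ.*_) (unit² (g 0) (Invertible.∣f₀∣≡1 inv)) ⟨
    h 0 ℤ.* (g 0 ℤ.* g 0)         ≡⟨ ℤ.*-assoc (h 0) (g 0) (g 0) ⟨
    h 0 ℤ.* g 0 ℤ.* g 0           ≡⟨ cong (ℤ._* g 0) (trans (sym (ℤ.+-identityʳ (h 0 ℤ.* g 0))) (hg≗f 0)) ⟩
    f 0 ℤ.* g 0                   ∎
    where open ≡-Reasoning

  cancel : ∀ a b → b ≡ a ℤ.+ b ℤ.- a
  cancel = solve-∀

  go : ∀ f h → h * g ≗ f → h ≗ f / g
  go f h hg≗f zero    = leading f h hg≗f
  go f h hg≗f (suc n) = go (remainder f g) (tail h) (λ m → begin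
    (tail h * g) m
      ≡⟨ cancel (h 0 ℤ.* g (suc m)) _ ⟩
    (h * g) (suc m) ℤ.- h 0 ℤ.* g (suc m)
      ≡⟨ cong₂ (λ i j → i ℤ.- j ℤ.* g (suc m)) (hg≗f (suc m)) (leading f h hg≗f) ⟩
    remainder f g m ∎) n
    where open ≡-Reasoning

-- Series of sets of natural numbers: disjoint unions and translates.

private
  variable
    P Q R : Pred ℕ 0ℓ

-- The indices `m` and `n` may differ, so that a shift of the exponent can be absorbed into the
-- predicate.
hilbertSeries-cong : (P? : Decidable P) (Q? : Decidable Q) → ∀ {m n} →
  P m ⇔ Q n → hilbertSeries P? m ≡ hilbertSeries Q? n
hilbertSeries-cong P? Q? {m} {n} P⇔Q with P? m | Q? n
... | yes _ | yes _ = refl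
... | yes p | no ¬q = ⊥-elim (¬q (Equivalence.to P⇔Q p))
... | no ¬p | yes q = ⊥-elim (¬p (Equivalence.from P⇔Q q))
... | no _  | no _  = refl

hilbertSeries-⊎ : (P? : Decidable P) (Q? : Decidable Q) (R? : Decidable R) → ∀ {n} →
  P n ⇔ (Q n ⊎ R n) → (Q n → ¬ R n) →
  hilbertSeries P? n ≡ hilbertSeries Q? n ℤ.+ hilbertSeries R? n
hilbertSeries-⊎ P? Q? R? {n} P⇔Q⊎R Q⇒¬R with P? n | Q? n | R? n
... | _     | yes q | yes r = ⊥-elim (Q⇒¬R q r)
... | yes _ | yes _ | no _  = refl
... | yes _ | no _  | yes _ = refl
... | yes p | no ¬q | no ¬r with Equivalence.to P⇔Q⊎R p
...   | inj₁ q = ⊥-elim (¬q q)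
...   | inj₂ r = ⊥-elim (¬r r)
hilbertSeries-⊎ P? Q? R? P⇔Q⊎R _ | no ¬p | yes q | no _  = ⊥-elim (¬p (Equivalence.from P⇔Q⊎R (inj₁ q)))
hilbertSeries-⊎ P? Q? R? P⇔Q⊎R _ | no ¬p | no _  | yes r = ⊥-elim (¬p (Equivalence.from P⇔Q⊎R (inj₂ r)))
hilbertSeries-⊎ P? Q? R? P⇔Q⊎R _ | no _  | no _  | no _  = refl

-- The set k + P. The bound excludes `n < k`, where truncated subtraction would give 0.
Translate : ℕ → Pred ℕ 0ℓ → Pred ℕ 0ℓ
Translate k P n = k ≤ n × P (n ∸ k)

translate? : ∀ k → Decidable P → Decidable (Translate k P)
translate? k P? n = k ℕ.≤? n ×-dec P? (n ∸ k)

-- Induction on `k`: `x^ (suc k)` has constant coefficient 0 and tail `x^ k`, so each step shifts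
-- the set by one.
x^-* : ∀ k (P? : Decidable P) →
  x^ k * hilbertSeries P? ≗ hilbertSeries (translate? k P?)
x^-* zero P? n = trans
  (*-identityˡ (hilbertSeries P?) n)
  (hilbertSeries-cong P? (translate? 0 P?) (mk⇔ (z≤n ,_) λ (_ , p) → p))
x^-* (suc k) P? zero    = refl
x^-* (suc k) P? (suc n) = begin
  0ℤ ℤ.+ (x^ k * hilbertSeries P?) n
    ≡⟨ ℤ.+-identityˡ _ ⟩
  (x^ k * hilbertSeries P?) n
    ≡⟨ x^-* k P? n ⟩
  hilbertSeries (translate? k P?) n
    ≡⟨ hilbertSeries-cong (translate? k P?) (translate? (suc k) P?)
         (mk⇔ (λ (k≤n , p) → s≤s k≤n , p) λ { (s≤s k≤n , p) → k≤n , p }) ⟩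
  hilbertSeries (translate? (suc k) P?) (suc n)
    ∎
  where open ≡-Reasoning

one-minus-x^-* : ∀ k (P? : Decidable P) →
  (one - x^ k) * hilbertSeries P? ≗ hilbertSeries P? - hilbertSeries (translate? k P?)
one-minus-x^-* k P? n = trans
  (one-minus-* (x^ k) (hilbertSeries P?) n)
  (cong (λ i → hilbertSeries P? n ℤ.- i) (x^-* k P? n))

-- Finite geometric sums in powers of x^p.

Multiples : ℕ → ℕ → Pred ℕ 0ℓ
Multiples p m n = ∃ λ a → a < m × n ≡ a ℕ.* p

multiples? : ∀ p m → Decidable (Multiples p m)
multiples? p m n = ℕ.anyUpTo? (λ a → n ℕ.≟ a ℕ.* p) m

-- {ap : a ≤ m} is both {ap : a < m} ⊔ {mp} and {0} ⊔ (p + {ap : a < m}).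
geometric : ∀ p m .{{_ : NonZero p}} →
  (one - x^ p) * hilbertSeries (multiples? p m) ≗ one - x^ (m ℕ.* p)
geometric p m n = trans
  (one-minus-x^-* p (multiples? p m) n)
  (lemma (M n) (x^mp n) (one n) (pM n) (trans (sym splitLast) splitFirst))
  where
  M    = hilbertSeries (multiples? p m)
  pM   = hilbertSeries (translate? p (multiples? p m))
  x^mp = x^ (m ℕ.* p)

  lemma : ∀ a b c d → a ℤ.+ b ≡ c ℤ.+ d → a ℤ.- d ≡ c ℤ.- b
  lemma a b c d eq = begin
    a ℤ.- d                     ≡⟨ solve (a ∷ b ∷ d ∷ []) ⟩
    (a ℤ.+ b) ℤ.- b ℤ.- d       ≡⟨ cong (λ i → i ℤ.- b ℤ.- d) eq ⟩
    (c ℤ.+ d) ℤ.- b ℤ.- d       ≡⟨ solve (b ∷ c ∷ d ∷ []) ⟩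
    c ℤ.- b                     ∎
    where open ≡-Reasoning

  splitLast : hilbertSeries (multiples? p (suc m)) n ≡ M n ℤ.+ x^mp n
  splitLast = hilbertSeries-⊎ (multiples? p (suc m)) (multiples? p m) (ℕ._≟ m ℕ.* p)
    (mk⇔ to from) disjoint
    where
    to : Multiples p (suc m) n → Multiples p m n ⊎ n ≡ m ℕ.* p
    to (a , s≤s a≤m , n≡ap) with ℕ.m≤n⇒m<n∨m≡n a≤m
    ... | inj₁ a<m  = inj₁ (a , a<m , n≡ap)
    ... | inj₂ refl = inj₂ n≡ap
    from : Multiples p m n ⊎ n ≡ m ℕ.* p → Multiples p (suc m) n
    from (inj₁ (a , a<m , n≡ap)) = a , ℕ.m<n⇒m<1+n a<m , n≡ap
    from (inj₂ n≡mp)             = m , ℕ.≤-refl , n≡mp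
    disjoint : Multiples p m n → ¬ n ≡ m ℕ.* p
    disjoint (a , a<m , refl) ap≡mp = ℕ.<⇒≢ a<m (ℕ.*-cancelʳ-≡ a m p ap≡mp)

  splitFirst : hilbertSeries (multiples? p (suc m)) n ≡ one n ℤ.+ pM n
  splitFirst = hilbertSeries-⊎ (multiples? p (suc m)) (ℕ._≟ 0) (translate? p (multiples? p m))
    (mk⇔ to from) disjoint
    where
    to : Multiples p (suc m) n → n ≡ 0 ⊎ Translate p (Multiples p m) n
    to (zero  , _       , n≡0)  = inj₁ n≡0
    to (suc a , s≤s a<m , refl) = inj₂ (ℕ.m≤m+n p _ , a , a<m , ℕ.m+n∸m≡n p _)
    from : n ≡ 0 ⊎ Translate p (Multiples p m) n → Multiples p (suc m) n
    from (inj₁ n≡0)                         = 0 , s≤s z≤n , n≡0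
    from (inj₂ (p≤n , a , a<m , n∸p≡ap)) =
      suc a , s≤s a<m , trans (sym (ℕ.m+[n∸m]≡n p≤n)) (cong (p ℕ.+_) n∸p≡ap)
    disjoint : n ≡ 0 → ¬ Translate p (Multiples p m) n
    disjoint refl (p≤0 , _) = ℕ.<⇒≱ (ℕ.>-nonZero⁻¹ p) p≤0

-- An element ap + bq with b > 0 lies in q + S(p,q), and so does ap with a ≥ q, after q copies of p
-- are traded for p copies of q. What remains is ap with a < q, and coprimality keeps these elements
-- out of q + S(p,q).
apéry : ∀ p q .{{_ : NonZero p}} .{{_ : NonZero q}} → Coprime p q →
  (one - x^ q) * hilbertSeries (S? p q) ≗ hilbertSeries (multiples? p q)
apéry p q coprime n = trans
  (one-minus-x^-* q (S? p q) n)
  (trans (cong (λ i → i ℤ.- qS n) split) (cancel (A n) (qS n)))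
  where
  A  = hilbertSeries (multiples? p q)
  qS = hilbertSeries (translate? q (S? p q))

  cancel : ∀ a b → a ℤ.+ b ℤ.- b ≡ a
  cancel = solve-∀

  -- Of the `p` copies of `q` obtained in the trade, one is set apart as the translation, which
  -- leaves `pred p`.
  exchange : ∀ a → q ≤ a → a ℕ.* p ≡ q ℕ.+ ((a ∸ q) ℕ.* p ℕ.+ ℕ.pred p ℕ.* q)
  exchange a q≤a = begin
    a ℕ.* p                                       ≡⟨ cong (ℕ._* p) (ℕ.m∸n+n≡m q≤a) ⟨
    (a ∸ q ℕ.+ q) ℕ.* p                           ≡⟨ ℕ.*-distribʳ-+ p (a ∸ q) q ⟩
    (a ∸ q) ℕ.* p ℕ.+ q ℕ.* p                     ≡⟨ cong (λ r → (a ∸ q) ℕ.* p ℕ.+ r) (ℕ.*-comm q p) ⟩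
    (a ∸ q) ℕ.* p ℕ.+ p ℕ.* q                     ≡⟨ cong (λ r → (a ∸ q) ℕ.* p ℕ.+ r ℕ.* q) (ℕ.suc-pred p) ⟨
    (a ∸ q) ℕ.* p ℕ.+ (q ℕ.+ ℕ.pred p ℕ.* q)      ≡⟨ x∙yz≈y∙xz ((a ∸ q) ℕ.* p) q (ℕ.pred p ℕ.* q) ⟩
    q ℕ.+ ((a ∸ q) ℕ.* p ℕ.+ ℕ.pred p ℕ.* q)      ∎
    where open ≡-Reasoning

  translated : ∀ {m} → n ≡ q ℕ.+ m → S p q m → Translate q (S p q) n
  translated {m} refl m∈S = ℕ.m≤m+n q m , subst (S p q) (sym (ℕ.m+n∸m≡n q m)) m∈S

  to : S p q n → Multiples p q n ⊎ Translate q (S p q) n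
  to (a , suc b , n≡) = inj₂ (translated (trans n≡ (x∙yz≈y∙xz (a ℕ.* p) q (b ℕ.* q))) (a , b , refl))
  to (a , zero , n≡) with a ℕ.<? q
  ... | yes a<q = inj₁ (a , a<q , trans n≡ (ℕ.+-identityʳ _))
  ... | no  a≮q = inj₂ (translated
    (trans n≡ (trans (ℕ.+-identityʳ _) (exchange a (ℕ.≮⇒≥ a≮q))))
    (a ∸ q , ℕ.pred p , refl))

  positive : Translate q (S p q) n → ∃₂ λ a b → n ≡ a ℕ.* p ℕ.+ suc b ℕ.* q
  positive (q≤n , a , b , n∸q≡) = a , b , (begin
    n                                  ≡⟨ ℕ.m+[n∸m]≡n q≤n ⟨
    q ℕ.+ (n ∸ q)                      ≡⟨ cong (q ℕ.+_) n∸q≡ ⟩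
    q ℕ.+ (a ℕ.* p ℕ.+ b ℕ.* q)        ≡⟨ x∙yz≈y∙xz q (a ℕ.* p) (b ℕ.* q) ⟩
    a ℕ.* p ℕ.+ (q ℕ.+ b ℕ.* q)        ∎)
    where open ≡-Reasoning

  from : Multiples p q n ⊎ Translate q (S p q) n → S p q n
  from (inj₁ (a , _ , n≡ap)) = a , 0 , trans n≡ap (sym (ℕ.+-identityʳ _))
  from (inj₂ n∈qS) with a , b , n≡ ← positive n∈qS = a , suc b , n≡

  disjoint : Multiples p q n → ¬ Translate q (S p q) n
  disjoint (a , a<q , n≡ap) n∈qS with c , d , n≡ ← positive n∈qS =
    -- From ap = cp + (d + 1)q follows p(a - c) = (d + 1)q, so `q` divides a - c by coprimality,
    -- although 0 < a - c ≤ a < q.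
    >⇒∤ (ℕ.≤-<-trans (ℕ.m∸n≤m a c) a<q)
      (coprime-divisor (Coprimality.sym coprime) (divides (suc d) difference))
    where
    difference : p ℕ.* (a ∸ c) ≡ suc d ℕ.* q
    difference = begin
      p ℕ.* (a ∸ c)                                ≡⟨ ℕ.*-distribˡ-∸ p a c ⟩
      p ℕ.* a ∸ p ℕ.* c                            ≡⟨ cong₂ _∸_ (ℕ.*-comm p a) (ℕ.*-comm p c) ⟩
      a ℕ.* p ∸ c ℕ.* p                            ≡⟨ cong (_∸ c ℕ.* p) (trans (sym n≡ap) n≡) ⟩
      c ℕ.* p ℕ.+ suc d ℕ.* q ∸ c ℕ.* p            ≡⟨ ℕ.m+n∸m≡n (c ℕ.* p) _ ⟩
      suc d ℕ.* q                                  ∎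
      where open ≡-Reasoning
    instance
      -- The positive coefficient `suc d` of `q` makes p(a - c) nonzero, so the truncated difference
      -- cannot be 0.
      a∸c≢0 : NonZero (a ∸ c)
      a∸c≢0 = ℕ.m*n≢0⇒n≢0 p {{subst NonZero (sym difference) (ℕ.m*n≢0 (suc d) q)}}

  split : hilbertSeries (S? p q) n ≡ A n ℤ.+ qS n
  split = hilbertSeries-⊎ (S? p q) (multiples? p q) (translate? q (S? p q)) (mk⇔ to from) disjoint

theorem1 : ∀ (p q : ℕ) .{{_ : NonTrivial p}} .{{_ : NonTrivial q}} → Coprime p q →
    (semigroupPolynomial (S? p q) ≗ (one - x) * hilbertSeries (S? p q)) ×
    ((one - x) * hilbertSeries (S? p q) ≗
    ((x^ (p ℕ.* q) - one) * (x - one)) / ((x^ p - one) * (x^ q - one)))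
-- The first equality is the definition of the semigroup polynomial. For the second, uniqueness of
-- quotients leaves the product with the denominator to be computed.
theorem1 p q coprime = (λ _ → refl) , /-unique _ _ _ (begin
  ((one - x) * H) * G                   ≈⟨ *-assoc (one - x) H G ⟩
  (one - x) * (H * G)                   ≈⟨ *-congˡ (one - x) (*-comm H G) ⟩
  (one - x) * (G * H)                   ≈⟨ *-congˡ (one - x) G*H ⟩
  (one - x) * (one - x^ (p ℕ.* q))      ≈⟨ *-comm (one - x) (one - x^ (p ℕ.* q)) ⟩
  (one - x^ (p ℕ.* q)) * (one - x)      ≈⟨ swap-signs one (x^ (p ℕ.* q)) one x ⟩
  (x^ (p ℕ.* q) - one) * (x - one)      ∎)
  where
  open ≈-Reasoning (ℕ →-setoid ℤ)

  H = hilbertSeries (S? p q)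
  G = (x^ p - one) * (x^ q - one)
  instance
    p≢0 : NonZero p
    p≢0 = ℕ.nonTrivial⇒nonZero p
    q≢0 : NonZero q
    q≢0 = ℕ.nonTrivial⇒nonZero q

  G*H : G * H ≗ one - x^ (p ℕ.* q)
  G*H = begin
    G * H                                        ≈⟨ *-congʳ H (swap-signs (x^ p) one (x^ q) one) ⟩
    ((one - x^ p) * (one - x^ q)) * H            ≈⟨ *-assoc (one - x^ p) (one - x^ q) H ⟩
    (one - x^ p) * ((one - x^ q) * H)            ≈⟨ *-congˡ (one - x^ p) (apéry p q coprime) ⟩
    (one - x^ p) * hilbertSeries (multiples? p q) ≈⟨ geometric p q ⟩
    one - x^ (q ℕ.* p)                           ≡⟨ cong (λ k → one - x^ k) (ℕ.*-comm q p) ⟩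
    one - x^ (p ℕ.* q)                           ∎
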